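{- For every integer $n\ge 0$, \[ \sum_{k=0}^{\infty}(-1)^{\lceil k/2\rceil}\,\overline{p}_o\!\left(n-\frac{k(k+1)}{2}\right)=\sum_{k=-\infty}^{\infty}(-1)^k\,p_d\bigl(n-k(3k+1)\bigr). \]
   Context: $\overline{p}_o(n)$ is the number of overpartitions of $n$ into odd parts (partitions into odd parts in which the first occurrence of each part size may be overlined), with $\sum_{n\ge0}\overline{p}_o(n)q^n=\frac{(-q;q^2)_\infty}{(q;q^2)_\infty}$, where $(a;q)_\infty=\prod_{k\ge1}(1-aq^{k-1})$. $p_d(n)$ is the number of partitions of $n$ into distinct parts, $\sum_{n\ge0}p_d(n)q^n=(-q;q)_\infty$. Convention: these functions vanish at arguments that are not nonnegative integers. -}

module Defs where

open import Data.Bool using (Bool; true; false; _∧_; not; if_then_else_)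
open import Data.Nat using (ℕ; zero; suc; _+_; _*_; _∸_; _≡ᵇ_; _≤ᵇ_; _/_; _%_)
open import Data.Product using (_×_; _,_)
open import Data.List using (List; []; _∷_; map; concatMap; filterᵇ; length; upTo; sum)
open import Data.Vec using (Vec; []; _∷_)
open import Data.Integer as ℤ using (ℤ; +_; -_)

vecsOver : {A : Set} → List A → (k : ℕ) → List (Vec A k)
vecsOver xs zero    = [] ∷ []
vecsOver xs (suc k) = concatMap (λ x → map (x ∷_) (vecsOver xs k)) xs

range0 : ℕ → List ℕ
range0 b = upTo (suc b)

isOdd : ℕ → Bool
isOdd j = j % 2 ≡ᵇ 1

-- Partitions of n into distinct parts.
-- A partition into distinct parts of n is a set of positive integers
-- (necessarily all ≤ n) with sum n.  We encode it by a vector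
-- b : Vec Bool n, where b[i] = true iff the part (i+1) occurs.

dsum : ℕ → {k : ℕ} → Vec Bool k → ℕ
dsum s []          = 0
dsum s (b ∷ bs)    = (if b then s else 0) + dsum (suc s) bs

distinctPartitions : (n : ℕ) → List (Vec Bool n)
distinctPartitions n = filterᵇ (λ v → dsum 1 v ≡ᵇ n) (vecsOver (true ∷ false ∷ []) n)

pd : ℕ → ℕ
pd n = length (distinctPartitions n)

-- Overpartitions of n into odd parts.
-- An overpartition of n into odd parts is given by, for each part size
-- j ∈ {1..n}, a multiplicity m_j (0 ≤ m_j ≤ n) and a flag o_j saying whether
-- the first occurrence of j is overlined, subject to:
--   * m_j = 0 whenever j is even (parts are odd),
--   * o_j = true only if m_j ≥ 1 (only an occurring part can be overlined),
--   * Σ j·m_j = n.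
-- Encoded as a vector of length n whose i-th entry is (m_{i+1}, o_{i+1}).

osum : ℕ → {k : ℕ} → Vec (ℕ × Bool) k → ℕ
osum s []             = 0
osum s ((m , o) ∷ v)  = s * m + osum (suc s) v

oValid : ℕ → {k : ℕ} → Vec (ℕ × Bool) k → Bool
oValid s []            = true
oValid s ((m , o) ∷ v) =
  (isOdd s ∨' (m ≡ᵇ 0)) ∧ (not o ∨' (1 ≤ᵇ m)) ∧ oValid (suc s) v
  where
  _∨'_ : Bool → Bool → Bool
  true  ∨' _ = true
  false ∨' b = b

entries : ℕ → List (ℕ × Bool)
entries n = concatMap (λ m → (m , true) ∷ (m , false) ∷ []) (range0 n)

oddOverpartitions : (n : ℕ) → List (Vec (ℕ × Bool) n)
oddOverpartitions n =
  filterᵇ (λ v → oValid 1 v ∧ (osum 1 v ≡ᵇ n)) (vecsOver (entries n) n)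

pobar : ℕ → ℕ
pobar n = length (oddOverpartitions n)

atℤ : (ℕ → ℕ) → ℤ → ℤ
atℤ f (+ m)      = + (f m)
atℤ f ℤ.-[1+ m ] = + 0

sumTo : ℕ → (ℕ → ℤ) → ℤ
sumTo zero    f = f 0
sumTo (suc N) f = sumTo N f ℤ.+ f (suc N)

sumSym : ℕ → (ℤ → ℤ) → ℤ
sumSym N f = sumTo (N + N) (λ i → f (+ i ℤ.- + N))

sgn : ℕ → ℤ
sgn zero    = + 1
sgn (suc e) = - sgn e

sgnℤ : ℤ → ℤ
sgnℤ k = sgn ℤ.∣ k ∣

ceilHalf : ℕ → ℕ
ceilHalf k = (k + 1) / 2

tri : ℕ → ℕ
tri k = (k * (k + 1)) / 2

{-# OPTIONS --safe #-}

-- Write T and B for the triangular and pentagonal theta series of the two sides, E for ∏(1 - q^(2i)) and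
-- O± for ∏(1 ± q^(2i-1)).  Then T O⁺ = E (Gauss) and B = E (Euler), while P O⁻ = O⁺ for the overpartition
-- series P and D O⁻ = 1 for the distinct-parts series D.  Hence T P O⁻ = T O⁺ = E = B = B D O⁻, and O⁻ cancels.
-- Both theta identities come, following Shanks, from one finite sum
--   F_n(x) = Σ_{s≤n} ∏_{s<i≤n} (1 - q^(2i)) · (-q^(2n+1))^s ∏_{i<s} (x + q^(2i+1)),
-- at x = 1 (Gauss) and x = 0 (Euler): its terms with s ≥ 1 vanish modulo q^(2n+1), and telescoping gives
--   F_{n+1} = (1 + x q^(2n+1)) F_n + (-q^(2n+1))^(n+1) ∏_{i≤n} (x + q^(2i+1)) · (1 + q^(2n+2)).
-- Everything is done modulo q^(n+1), so that only finite products occur.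
module Submission where

open import Defs
open import Data.Nat using (ℕ)
open import Data.Integer using (ℤ; +_; _*_; _-_; _+_)
open import Relation.Binary.PropositionalEquality using (_≡_)

open import Algebra.Bundles using (CommutativeRing)
open import Algebra.Solver.Ring.AlmostCommutativeRing
  using (fromCommutativeRing; _-Raw-AlmostCommutative⟶_; Induced-equivalence)
open import Data.Bool using (Bool; true; false; _∧_; if_then_else_)
open import Data.Integer as ℤ using (-_)
import Data.Integer.Properties as ℤₚ
open import Data.Integer.Solver using (module +-*-Solver)
open import Data.List using (List; []; _∷_; _++_; map; concatMap; length; filterᵇ)
open import Data.List.Properties using (concatMap-++; upTo-∷ʳ)
open import Data.Maybe using (just; nothing)
open import Data.Nat as ℕ using (zero; suc; _≤_; _<_; z≤n; s≤s)
import Data.Nat.Properties as ℕₚ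
open import Data.Nat.DivMod using ([m+n]%n≡m%n; m*n/n≡m; m/n≡1+[m∸n]/n; /-monoˡ-≤)
import Data.Nat.Solver
open import Data.Product using (_×_; _,_; proj₁)
open import Data.Sum using (inj₁; inj₂)
open import Data.Vec using (Vec; []; _∷_)
open import Relation.Binary.Bundles using (Setoid)
open import Relation.Binary.Definitions using (WeaklyDecidable)
open import Relation.Binary.PropositionalEquality
  using (refl; sym; trans; cong; cong₂; subst; module ≡-Reasoning)
import Relation.Binary.Reasoning.Setoid as SetoidReasoning
open import Relation.Nullary using (yes; no)
open import Algebra.Properties.Group (CommutativeRing.+-group ℤₚ.+-*-commutativeRing) using (∙-cancelˡ)

private
  module ℤS = +-*-Solver
  module ℕS = Data.Nat.Solver.+-*-Solver

-- Index arithmetic and finite sums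

ceilHalf-2+ : ∀ k → ceilHalf (suc (suc k)) ≡ suc (ceilHalf k)
ceilHalf-2+ k = m/n≡1+[m∸n]/n {suc (suc (k ℕ.+ 1))} {2} (s≤s (s≤s z≤n))

ceilHalf-odd : ∀ j → ceilHalf (suc (j ℕ.* 2)) ≡ suc j
ceilHalf-odd zero    = refl
ceilHalf-odd (suc j) = trans (ceilHalf-2+ (suc (j ℕ.* 2))) (cong suc (ceilHalf-odd j))

ceilHalf-even : ∀ j → ceilHalf (j ℕ.* 2) ≡ j
ceilHalf-even zero    = refl
ceilHalf-even (suc j) = trans (ceilHalf-2+ (j ℕ.* 2)) (cong suc (ceilHalf-even j))

tri-odd : ∀ j → tri (suc (j ℕ.* 2)) ≡ suc (j ℕ.* 2) ℕ.* suc j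
tri-odd j = trans
  (cong (ℕ._/ 2) (ℕS.solve 1 (λ j → (con 1 :+ j :* con 2) :* (con 1 :+ j :* con 2 :+ con 1)
                                   := (con 1 :+ j :* con 2) :* (con 1 :+ j) :* con 2) refl j))
  (m*n/n≡m _ 2)
  where open ℕS using (_:+_; _:*_; _:=_; con)

tri-even : ∀ j → tri (suc j ℕ.* 2) ≡ suc (j ℕ.* 2) ℕ.* suc j ℕ.+ suc j ℕ.* 2
tri-even j = trans
  (cong (ℕ._/ 2) (ℕS.solve 1 (λ j → ((con 1 :+ j) :* con 2) :* ((con 1 :+ j) :* con 2 :+ con 1)
                                   := ((con 1 :+ j :* con 2) :* (con 1 :+ j) :+ (con 1 :+ j) :* con 2) :* con 2) refl j))
  (m*n/n≡m _ 2)
  where open ℕS using (_:+_; _:*_; _:=_; con)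

k≤tri : ∀ k → k ≤ tri k
k≤tri zero    = z≤n
k≤tri (suc k) = subst (_≤ tri (suc k)) (m*n/n≡m (suc k) 2)
  (/-monoˡ-≤ 2 (ℕₚ.*-monoʳ-≤ (suc k) (s≤s (ℕₚ.m≤n+m 1 k))))

-- The triangular series produces its terms in pairs and so ends at index 2n; this trades that limit
-- for the n of the statement.
sumTo-extend : ∀ {n} {g : ℕ → ℤ} → (∀ k → n < k → g k ≡ + 0) → ∀ d → sumTo (n ℕ.+ d) g ≡ sumTo n g
sumTo-extend {n} {g} g≡0 zero rewrite ℕₚ.+-identityʳ n = refl
sumTo-extend {n} {g} g≡0 (suc d) rewrite ℕₚ.+-suc n d =
  trans (cong₂ _+_ (sumTo-extend g≡0 d) (g≡0 _ (s≤s (ℕₚ.m≤m+n n d)))) (ℤₚ.+-identityʳ _)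

sumTo-cong : ∀ {g h : ℕ → ℤ} → (∀ k → g k ≡ h k) → ∀ n → sumTo n g ≡ sumTo n h
sumTo-cong g≡h zero    = g≡h 0
sumTo-cong g≡h (suc n) = cong₂ _+_ (sumTo-cong g≡h n) (g≡h (suc n))

sumTo-head : ∀ n (g : ℕ → ℤ) → sumTo (suc n) g ≡ g 0 + sumTo n (λ k → g (suc k))
sumTo-head zero    g = refl
sumTo-head (suc n) g = trans (cong (_+ g (suc (suc n))) (sumTo-head n g)) (ℤₚ.+-assoc (g 0) _ _)

-- Peeling off the first and the last index leaves the smaller window shifted by one; this lets the
-- pentagonal series add k = -(n+1) and k = n+1 together.
sumSym-suc : ∀ n f → sumSym (suc n) f ≡ sumSym n f + (f (ℤ.-[1+ n ]) + f (+ suc n))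
sumSym-suc n f rewrite ℕₚ.+-suc n n = begin
  sumTo (suc (n ℕ.+ n)) g + f (+ suc (suc (n ℕ.+ n)) - + suc n)
    ≡⟨ cong₂ _+_ (sumTo-head (n ℕ.+ n) g) (cong f last) ⟩
  f ℤ.-[1+ n ] + sumTo (n ℕ.+ n) (λ k → g (suc k)) + f (+ suc n)
    ≡⟨ cong (λ z → f ℤ.-[1+ n ] + z + f (+ suc n)) (sumTo-cong (λ k → cong f (shift k)) (n ℕ.+ n)) ⟩
  f ℤ.-[1+ n ] + sumSym n f + f (+ suc n)
    ≡⟨ ℤS.solve 3 (λ a b c → a :+ b :+ c := b :+ (a :+ c)) refl (f ℤ.-[1+ n ]) (sumSym n f) (f (+ suc n)) ⟩
  sumSym n f + (f ℤ.-[1+ n ] + f (+ suc n)) ∎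
  where
  open ≡-Reasoning
  open ℤS using (_:+_; _:=_)
  g : ℕ → ℤ
  g k = f (+ k - + suc n)
  shift : ∀ k → + suc k - + suc n ≡ + k - + n
  shift k = trans (ℤₚ.[1+m]⊖[1+n]≡m⊖n k n) (sym (ℤₚ.m-n≡m⊖n k n))
  last : + suc (suc (n ℕ.+ n)) - + suc n ≡ + suc n
  last = trans (shift (suc (n ℕ.+ n)))
    (ℤS.solve 1 (λ a → con (+ 1) :+ (a :+ a) :- a := con (+ 1) :+ a) refl (+ n))
    where open ℤS using (_:-_; con)

-- Exponent of q in `shanksTerm 𝟘 n s`: s(2n+1) from the powers of q^(2n+1), and s² from 1 + 3 + ...
-- + (2s-1). At s = n+1 it is k(3k+1) for k = -(n+1), and adding 2(n+1) gives the value for k = n+1.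
pentagonalExponent : ℕ → ℕ → ℕ
pentagonalExponent n s = s ℕ.* (n ℕ.* 2 ℕ.+ 1 ℕ.+ s)

pentagonalExponent-suc : ∀ n s →
  pentagonalExponent n s ℕ.+ (suc (n ℕ.* 2) ℕ.+ suc (s ℕ.* 2)) ≡ pentagonalExponent n (suc s)
pentagonalExponent-suc = ℕS.solve 2 (λ n s →
    s :* (n :* con 2 :+ con 1 :+ s) :+ ((con 1 :+ n :* con 2) :+ (con 1 :+ s :* con 2))
      := (con 1 :+ s) :* (n :* con 2 :+ con 1 :+ (con 1 :+ s))) refl
  where open ℕS using (_:+_; _:*_; _:=_; con)

pos-pentagonalExponent : ∀ j → + pentagonalExponent j (suc j) ≡ (+ 1 + + j) * (+ j * + 2 + + 1 + (+ 1 + + j))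
pos-pentagonalExponent j =
  trans (ℤₚ.pos-* (suc j) _) (cong (λ z → + suc j * (z + + 1 + + suc j)) (ℤₚ.pos-* j 2))

pentagonalExponent-negative : ∀ j →
  + pentagonalExponent j (suc j) ≡ ℤ.-[1+ j ] * (+ 3 * ℤ.-[1+ j ] + + 1)
pentagonalExponent-negative j = trans (pos-pentagonalExponent j)
  (ℤS.solve 1 (λ j → (con (+ 1) :+ j) :* (j :* con (+ 2) :+ con (+ 1) :+ (con (+ 1) :+ j))
                   := :- (con (+ 1) :+ j) :* (con (+ 3) :* :- (con (+ 1) :+ j) :+ con (+ 1))) refl (+ j))
  where open ℤS using (_:+_; _:*_; :-_; _:=_; con)

pentagonalExponent-positive : ∀ j →
  + (pentagonalExponent j (suc j) ℕ.+ suc j ℕ.* 2) ≡ + suc j * (+ 3 * + suc j + + 1)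
pentagonalExponent-positive j = trans (cong₂ _+_ (pos-pentagonalExponent j) (ℤₚ.pos-* (suc j) 2))
  (ℤS.solve 1 (λ j → (con (+ 1) :+ j) :* (j :* con (+ 2) :+ con (+ 1) :+ (con (+ 1) :+ j)) :+ (con (+ 1) :+ j) :* con (+ 2)
                   := (con (+ 1) :+ j) :* (con (+ 3) :* (con (+ 1) :+ j) :+ con (+ 1))) refl (+ j))
  where open ℤS using (_:+_; _:*_; _:=_; con)

-- Formal power series over ℤ

PowerSeries : Set
PowerSeries = ℕ → ℤ

infix  4 _≈_
infixl 6 _⊕_
infixl 7 _⊗_
infix  8 ⊝_

record _≈_ (f g : PowerSeries) : Set where
  constructor mk≈
  field coeff : ∀ n → f n ≡ g n
open _≈_

constant : ℤ → PowerSeries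
constant a zero    = a
constant a (suc n) = + 0

𝟘 𝟙 q : PowerSeries
𝟘 _ = + 0
𝟙 = constant (+ 1)
q zero    = + 0
q (suc n) = 𝟙 n

tail : PowerSeries → PowerSeries
tail f n = f (suc n)

-- The Cauchy product is read off from f = f(0) + q · `tail f`, which makes every ring law an
-- induction on the coefficient index.
_⊕_ _⊗_ : PowerSeries → PowerSeries → PowerSeries
(f ⊕ g) n = f n + g n
(f ⊗ g) zero    = f 0 * g 0
(f ⊗ g) (suc n) = f 0 * g (suc n) + (tail f ⊗ g) n

⊝_ : PowerSeries → PowerSeries
(⊝ f) n = - f n

-- Coefficient n of a product involves only coefficients up to n of the factors; this is what makes
-- congruence modulo q^(N+1) multiplicative.
⊗-cong-at : ∀ n {f f′ g g′} → (∀ m → m ≤ n → f m ≡ f′ m) → (∀ m → m ≤ n → g m ≡ g′ m) →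
            (f ⊗ g) n ≡ (f′ ⊗ g′) n
⊗-cong-at zero    p r = cong₂ _*_ (p 0 z≤n) (r 0 z≤n)
⊗-cong-at (suc n) p r =
  cong₂ _+_ (cong₂ _*_ (p 0 z≤n) (r (suc n) ℕₚ.≤-refl))
            (⊗-cong-at n (λ m m≤n → p (suc m) (s≤s m≤n)) (λ m m≤n → r m (ℕₚ.m≤n⇒m≤1+n m≤n)))

-- The mirror image of the defining recursion, with the right factor split instead; it gives
-- commutativity, and it isolates the top coefficient of f in the cancellation law.
⊗-sucʳ : ∀ f g n → (f ⊗ g) (suc n) ≡ (f ⊗ tail g) n + f (suc n) * g 0
⊗-sucʳ f g zero    = refl
⊗-sucʳ f g (suc n) =
  trans (cong (λ z → f 0 * g (suc (suc n)) + z) (⊗-sucʳ (tail f) g n))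
        (sym (ℤₚ.+-assoc (f 0 * g (suc (suc n))) ((tail f ⊗ tail g) n) (f (suc (suc n)) * g 0)))

⊗-comm-at : ∀ n f g → (f ⊗ g) n ≡ (g ⊗ f) n
⊗-comm-at zero    f g = ℤₚ.*-comm (f 0) (g 0)
⊗-comm-at (suc n) f g = begin
  f 0 * g (suc n) + (tail f ⊗ g) n  ≡⟨ cong₂ _+_ (ℤₚ.*-comm (f 0) (g (suc n))) (⊗-comm-at n (tail f) g) ⟩
  g (suc n) * f 0 + (g ⊗ tail f) n  ≡⟨ ℤₚ.+-comm (g (suc n) * f 0) _ ⟩
  (g ⊗ tail f) n + g (suc n) * f 0  ≡⟨ ⊗-sucʳ g f n ⟨
  (g ⊗ f) (suc n)                   ∎
  where open ≡-Reasoning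

⊗-distribʳ-at : ∀ n h f g → ((f ⊕ g) ⊗ h) n ≡ (f ⊗ h) n + (g ⊗ h) n
⊗-distribʳ-at zero    h f g = ℤₚ.*-distribʳ-+ (h 0) (f 0) (g 0)
⊗-distribʳ-at (suc n) h f g =
  trans (cong (_+_ ((f 0 + g 0) * h (suc n))) (⊗-distribʳ-at n h (tail f) (tail g)))
        (ℤS.solve 5 (λ a b c x y → (a :+ b) :* c :+ (x :+ y) := (a :* c :+ x) :+ (b :* c :+ y)) refl
                    (f 0) (g 0) (h (suc n)) ((tail f ⊗ h) n) ((tail g ⊗ h) n))
  where open ℤS using (_:+_; _:*_; _:=_)

⊗-scaleˡ-at : ∀ n c f g → ((λ m → c * f m) ⊗ g) n ≡ c * (f ⊗ g) n
⊗-scaleˡ-at zero    c f g = ℤₚ.*-assoc c (f 0) (g 0)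
⊗-scaleˡ-at (suc n) c f g =
  trans (cong (_+_ (c * f 0 * g (suc n))) (⊗-scaleˡ-at n c (tail f) g))
        (ℤS.solve 4 (λ c a b x → c :* a :* b :+ c :* x := c :* (a :* b :+ x)) refl
                    c (f 0) (g (suc n)) ((tail f ⊗ g) n))
  where open ℤS using (_:+_; _:*_; _:=_)

⊗-assoc-at : ∀ n f g h → ((f ⊗ g) ⊗ h) n ≡ (f ⊗ (g ⊗ h)) n
⊗-assoc-at zero    f g h = ℤₚ.*-assoc (f 0) (g 0) (h 0)
⊗-assoc-at (suc n) f g h = begin
  f 0 * g 0 * h (suc n) + (((λ m → f 0 * tail g m) ⊕ (tail f ⊗ g)) ⊗ h) n
    ≡⟨ cong (_+_ (f 0 * g 0 * h (suc n))) (⊗-distribʳ-at n h (λ m → f 0 * tail g m) (tail f ⊗ g)) ⟩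
  f 0 * g 0 * h (suc n) + (((λ m → f 0 * tail g m) ⊗ h) n + ((tail f ⊗ g) ⊗ h) n)
    ≡⟨ cong (_+_ (f 0 * g 0 * h (suc n)))
            (cong₂ _+_ (⊗-scaleˡ-at n (f 0) (tail g) h) (⊗-assoc-at n (tail f) g h)) ⟩
  f 0 * g 0 * h (suc n) + (f 0 * (tail g ⊗ h) n + (tail f ⊗ (g ⊗ h)) n)
    ≡⟨ ℤS.solve 5 (λ a b c x y → a :* b :* c :+ (a :* x :+ y) := a :* (b :* c :+ x) :+ y) refl
                (f 0) (g 0) (h (suc n)) ((tail g ⊗ h) n) ((tail f ⊗ (g ⊗ h)) n) ⟩
  f 0 * (g ⊗ h) (suc n) + (tail f ⊗ (g ⊗ h)) n ∎
  where
  open ≡-Reasoning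
  open ℤS using (_:+_; _:*_; _:=_)

⊗-zeroˡ-at : ∀ n f → (𝟘 ⊗ f) n ≡ + 0
⊗-zeroˡ-at zero    f = refl
⊗-zeroˡ-at (suc n) f = trans (ℤₚ.+-identityˡ _) (⊗-zeroˡ-at n f)

constant-⊗ : ∀ a f n → (constant a ⊗ f) n ≡ a * f n
constant-⊗ a f zero    = refl
constant-⊗ a f (suc n) = trans (cong (_+_ (a * f (suc n))) (⊗-zeroˡ-at n f)) (ℤₚ.+-identityʳ _)

powerSeriesRing : CommutativeRing _ _
powerSeriesRing = record
  { Carrier = PowerSeries
  ; _≈_ = _≈_
  ; _+_ = _⊕_
  ; _*_ = _⊗_
  ; -_  = ⊝_
  ; 0#  = 𝟘
  ; 1#  = 𝟙
  ; isCommutativeRing = record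
    { isRing = record
      { +-isAbelianGroup = record
        { isGroup = record
          { isMonoid = record
            { isSemigroup = record
              { isMagma = record
                { isEquivalence = record
                  { refl  = mk≈ λ _ → refl
                  ; sym   = λ p → mk≈ λ n → sym (coeff p n)
                  ; trans = λ p r → mk≈ λ n → trans (coeff p n) (coeff r n)
                  }
                ; ∙-cong = λ p r → mk≈ λ n → cong₂ _+_ (coeff p n) (coeff r n)
                }
              ; assoc = λ f g h → mk≈ λ n → ℤₚ.+-assoc (f n) (g n) (h n)
              }
            ; identity = (λ f → mk≈ λ n → ℤₚ.+-identityˡ (f n)) , (λ f → mk≈ λ n → ℤₚ.+-identityʳ (f n))
            }
          ; inverse = (λ f → mk≈ λ n → ℤₚ.+-inverseˡ (f n)) , (λ f → mk≈ λ n → ℤₚ.+-inverseʳ (f n))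
          ; ⁻¹-cong = λ p → mk≈ λ n → cong -_ (coeff p n)
          }
        ; comm = λ f g → mk≈ λ n → ℤₚ.+-comm (f n) (g n)
        }
      ; *-cong = λ p r → mk≈ λ n → ⊗-cong-at n (λ m _ → coeff p m) (λ m _ → coeff r m)
      ; *-assoc = λ f g h → mk≈ λ n → ⊗-assoc-at n f g h
      ; *-identity = (λ f → mk≈ (𝟙-⊗ f)) , (λ f → mk≈ λ n → trans (⊗-comm-at n f 𝟙) (𝟙-⊗ f n))
      ; distrib =
          (λ h f g → mk≈ λ n →
             trans (⊗-comm-at n h (f ⊕ g))
             (trans (⊗-distribʳ-at n h f g) (cong₂ _+_ (⊗-comm-at n f h) (⊗-comm-at n g h))))
        , (λ h f g → mk≈ λ n → ⊗-distribʳ-at n h f g)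
      }
    ; *-comm = λ f g → mk≈ λ n → ⊗-comm-at n f g
    }
  }
  where
  𝟙-⊗ : ∀ f n → (𝟙 ⊗ f) n ≡ f n
  𝟙-⊗ f n = trans (constant-⊗ (+ 1) f n) (ℤₚ.*-identityˡ (f n))

open CommutativeRing powerSeriesRing
  using (setoid; commutativeSemiring)
  renaming ( refl to ≈-refl; sym to ≈-sym; trans to ≈-trans
           ; +-cong to ⊕-cong; +-congˡ to ⊕-congˡ; +-congʳ to ⊕-congʳ; -‿cong to ⊝-cong
           ; +-assoc to ⊕-assoc; +-identityˡ to ⊕-identityˡ; +-identityʳ to ⊕-identityʳ
           ; *-cong to ⊗-cong; *-congˡ to ⊗-congˡ; *-congʳ to ⊗-congʳ
           ; *-assoc to ⊗-assoc; *-comm to ⊗-comm; *-identityˡ to ⊗-identityˡ; *-identityʳ to ⊗-identityʳ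
           ; zeroˡ to ⊗-zeroˡ; zeroʳ to ⊗-zeroʳ; distribˡ to ⊗-distribˡ; distribʳ to ⊗-distribʳ)
open import Algebra.Properties.CommutativeSemiring.Exp commutativeSemiring
  using (_^_; ^-homo-*; ^-distrib-*; ^-congˡ; ^-congʳ; ^-assocʳ)

-- Embeds ℤ as the constant series, so that the ring solver can decide polynomial identities between
-- series with integer coefficients.
constantHomomorphism : ℤ.+-*-rawRing -Raw-AlmostCommutative⟶ fromCommutativeRing powerSeriesRing
constantHomomorphism = record
  { ⟦_⟧    = constant
  ; +-homo = λ a b → mk≈ λ { zero → refl ; (suc n) → refl }
  ; *-homo = λ a b → mk≈ λ { zero → refl
                           ; (suc n) → sym (trans (constant-⊗ a (constant b) (suc n)) (ℤₚ.*-zeroʳ a)) }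
  ; -‿homo = λ a → mk≈ λ { zero → refl ; (suc n) → refl }
  ; 0-homo = mk≈ λ { zero → refl ; (suc n) → refl }
  ; 1-homo = ≈-refl
  }

constant≟ : WeaklyDecidable (Induced-equivalence constantHomomorphism)
constant≟ a b with a ℤ.≟ b
... | yes refl = just ≈-refl
... | no  _    = nothing

open import Algebra.Solver.Ring ℤ.+-*-rawRing (fromCommutativeRing powerSeriesRing) constantHomomorphism constant≟
  using (solve; _:=_; _:+_; _:*_; _:-_; :-_; con)

-- Finite q-products and the telescoping identity

prod : (ℕ → PowerSeries) → ℕ → ℕ → PowerSeries
prod f s zero    = 𝟙
prod f s (suc k) = f s ⊗ prod f (suc s) k

prod-snoc : ∀ f s k → prod f s (suc k) ≈ prod f s k ⊗ f (s ℕ.+ k)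
prod-snoc f s zero rewrite ℕₚ.+-identityʳ s = ⊗-comm (f s) 𝟙
prod-snoc f s (suc k) rewrite ℕₚ.+-suc s k =
  ≈-trans (⊗-congˡ (prod-snoc f (suc s) k)) (≈-sym (⊗-assoc (f s) _ _))

q² : PowerSeries
q² = q ⊗ q

evenFactor : ℕ → PowerSeries
evenFactor j = 𝟙 ⊕ ⊝ (q² ^ j)

-- The part (-q^(2n+1))^s ∏_{i<s} (x + q^(2i+1)) of summand s of F_n(x).
shanksTerm : PowerSeries → ℕ → ℕ → PowerSeries
shanksTerm x n zero    = 𝟙
shanksTerm x n (suc s) = shanksTerm x n s ⊗ (⊝ (q ⊗ q² ^ n) ⊗ (x ⊕ q ⊗ q² ^ s))

-- Raising n by one multiplies each of the s factors -q^(2n+1) by q².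
shanksTerm-suc : ∀ x n s → shanksTerm x (suc n) s ≈ shanksTerm x n s ⊗ q² ^ s
shanksTerm-suc x n zero    = ≈-sym (⊗-identityˡ 𝟙)
shanksTerm-suc x n (suc s) =
  ≈-trans (⊗-congʳ (shanksTerm-suc x n s))
    (solve 6 (λ u S A v r b → u :* S :* (:- (v :* (r :* A)) :* b) := u :* (:- (v :* A) :* b) :* (r :* S)) ≈-refl
       (shanksTerm x n s) (q² ^ s) (q² ^ n) q q² (x ⊕ q ⊗ q² ^ s))

-- The part s ≤ j ≤ s + r of Σ_j ∏_{j<i≤s+r} (1 - q^(2i)) · shanksTerm x n j; F_n(x) is shanksSum x n 0 n.
shanksSum : PowerSeries → ℕ → ℕ → ℕ → PowerSeries
shanksSum x n s zero    = prod evenFactor (suc s) 0 ⊗ shanksTerm x n s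
shanksSum x n s (suc r) = prod evenFactor (suc s) (suc r) ⊗ shanksTerm x n s ⊕ shanksSum x n (suc s) r

-- Summand s of F_{n+1}, minus 1 + x q^(2n+1) times summand s of F_n, is boundary s+1 minus boundary s.
shanksBoundary : PowerSeries → ℕ → ℕ → ℕ → PowerSeries
shanksBoundary x n s r = evenFactor s ⊗ prod evenFactor (suc s) r ⊗ shanksTerm x n s

-- Induction on r adds the boundary differences from s up to n. At the top, boundary n+1 is an empty
-- product times `shanksTerm x n (suc n)`, and summand n+1 of F_{n+1} is that same term times
-- q^(2n+2); together they form the last term on the right.
shanksSum-telescope : ∀ x n r s → s ℕ.+ r ≡ n →
  shanksSum x (suc n) s (suc r) ⊕ shanksBoundary x n s r
    ≈ (𝟙 ⊕ x ⊗ (q ⊗ q² ^ n)) ⊗ shanksSum x n s r ⊕ shanksTerm x n (suc n) ⊗ (𝟙 ⊕ q² ^ suc n)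
shanksSum-telescope x n zero s s+0≡n with trans (sym (ℕₚ.+-identityʳ s)) s+0≡n
... | refl =
  ≈-trans
    (⊕-cong (⊕-cong (⊗-congˡ u′) (⊗-congˡ (⊗-congʳ u′))) ≈-refl)
    (solve 4 (λ x v A u →
       let one = con (+ 1); S = v :* v :* A in
       (one :- S) :* one :* (u :* A) :+ one :* (u :* A :* (:- (v :* S) :* (x :+ v :* A)))
         :+ (one :- A) :* one :* u
         := (one :+ x :* (v :* A)) :* (one :* u) :+ u :* (:- (v :* A) :* (x :+ v :* A)) :* (one :+ S))
       ≈-refl x q (q² ^ n) (shanksTerm x n n))
  where u′ = shanksTerm-suc x n n
shanksSum-telescope x n (suc r) s s+r≡n = begin
  (t′ ⊕ rest′) ⊕ g        ≈⟨ ⊕-cong (⊕-cong t′≈t″ ≈-refl) ≈-refl ⟩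
  (t″ ⊕ rest′) ⊕ g        ≈⟨ solve 3 (λ a b c → (a :+ b) :+ c := (a :+ c) :+ b) ≈-refl t″ rest′ g ⟩
  (t″ ⊕ g) ⊕ rest′        ≈⟨ ⊕-cong t″⊕g≈ ≈-refl ⟩
  (c ⊗ t ⊕ g₁) ⊕ rest′    ≈⟨ solve 3 (λ a b c → (a :+ b) :+ c := a :+ (c :+ b)) ≈-refl (c ⊗ t) g₁ rest′ ⟩
  c ⊗ t ⊕ (rest′ ⊕ g₁)    ≈⟨ ⊕-congˡ {c ⊗ t} (shanksSum-telescope x n r (suc s) 1+s+r≡n) ⟩
  c ⊗ t ⊕ (c ⊗ rest ⊕ z)  ≈⟨ solve 4 (λ c t b z → c :* t :+ (c :* b :+ z) := c :* (t :+ b) :+ z) ≈-refl c t rest z ⟩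
  c ⊗ (t ⊕ rest) ⊕ z      ∎
  where
  open SetoidReasoning setoid
  1+s+r≡n : suc s ℕ.+ r ≡ n
  1+s+r≡n = trans (sym (ℕₚ.+-suc s r)) s+r≡n
  c t t′ t″ rest rest′ g g₁ z : PowerSeries
  c     = 𝟙 ⊕ x ⊗ (q ⊗ q² ^ n)
  t     = prod evenFactor (suc s) (suc r) ⊗ shanksTerm x n s
  t′    = prod evenFactor (suc s) (suc (suc r)) ⊗ shanksTerm x (suc n) s
  t″    = prod evenFactor (suc s) (suc r) ⊗ evenFactor (suc n) ⊗ (shanksTerm x n s ⊗ q² ^ s)
  rest  = shanksSum x n (suc s) r
  rest′ = shanksSum x (suc n) (suc s) (suc r)
  g     = shanksBoundary x n s (suc r)
  g₁    = shanksBoundary x n (suc s) r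
  z     = shanksTerm x n (suc n) ⊗ (𝟙 ⊕ q² ^ suc n)
  t′≈t″ : t′ ≈ t″
  t′≈t″ = ⊗-cong
    (subst (λ m → prod evenFactor (suc s) (suc (suc r)) ≈ prod evenFactor (suc s) (suc r) ⊗ evenFactor (suc m))
           s+r≡n (prod-snoc evenFactor (suc s) (suc r)))
    (shanksTerm-suc x n s)
  -- After removing common factors this is (1 - q^(2n+2)) q^(2s) + (1 - q^(2s)) = 1 - q^(2n+2s+2) =
  -- (1 + x q^(2n+1)) - q^(2n+1) (x + q^(2s+1)).
  t″⊕g≈ : t″ ⊕ g ≈ c ⊗ t ⊕ g₁
  t″⊕g≈ = solve 6 (λ x v A u S e →
      let one = con (+ 1); d = one :- v :* v :* S in
      d :* e :* (one :- v :* v :* A) :* (u :* S) :+ (one :- S) :* (d :* e) :* u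
        := (one :+ x :* (v :* A)) :* (d :* e :* u) :+ d :* e :* (u :* (:- (v :* A) :* (x :+ v :* S))))
    ≈-refl x q (q² ^ n) (shanksTerm x n s) (q² ^ s) (prod evenFactor (suc (suc s)) r)

shanksSum-suc : ∀ x n →
  shanksSum x (suc n) 0 (suc n)
    ≈ (𝟙 ⊕ x ⊗ (q ⊗ q² ^ n)) ⊗ shanksSum x n 0 n ⊕ shanksTerm x n (suc n) ⊗ (𝟙 ⊕ q² ^ suc n)
shanksSum-suc x n =
  ≈-trans
    -- The boundary at s = 0 contains `evenFactor 0` = 1 - 1, so it may be added freely.
    (solve 3 (λ a e u → a := a :+ (con (+ 1) :- con (+ 1)) :* e :* u) ≈-refl
       (shanksSum x (suc n) 0 (suc n)) (prod evenFactor 1 n) (shanksTerm x n 0))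
    (shanksSum-telescope x n n 0 refl)

-- The triangular and pentagonal theta series as values of the finite sum

oddProduct : PowerSeries → ℕ → PowerSeries
oddProduct ε zero    = 𝟙
oddProduct ε (suc n) = oddProduct ε n ⊗ (𝟙 ⊕ ε ⊗ (q ⊗ q² ^ n))

-- The sum of (-1)^⌈k/2⌉ q^(k(k+1)/2) over k ≤ 2n, where each step adds k = 2n+1 and k = 2n+2.
triangularSeries : ℕ → PowerSeries
triangularSeries zero    = 𝟙
triangularSeries (suc n) = triangularSeries n ⊕ (⊝ (q ⊗ q² ^ n)) ^ suc n ⊗ (𝟙 ⊕ q² ^ suc n)

-- The sum of (-1)^k q^(k(3k+1)) over |k| ≤ n, where each step adds k = -(n+1) and k = n+1.
pentagonalSeries : ℕ → PowerSeries
pentagonalSeries zero    = 𝟙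
pentagonalSeries (suc n) = pentagonalSeries n ⊕ shanksTerm 𝟘 n (suc n) ⊗ (𝟙 ⊕ q² ^ suc n)

shanksTerm-𝟙 : ∀ n s → shanksTerm 𝟙 n s ≈ (⊝ (q ⊗ q² ^ n)) ^ s ⊗ oddProduct 𝟙 s
shanksTerm-𝟙 n zero    = ≈-sym (⊗-identityˡ 𝟙)
shanksTerm-𝟙 n (suc s) =
  ≈-trans (⊗-congʳ (shanksTerm-𝟙 n s))
    (solve 4 (λ y p o b → p :* o :* (y :* (con (+ 1) :+ b)) := y :* p :* (o :* (con (+ 1) :+ con (+ 1) :* b))) ≈-refl
       (⊝ (q ⊗ q² ^ n)) ((⊝ (q ⊗ q² ^ n)) ^ s) (oddProduct 𝟙 s) (q ⊗ q² ^ s))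

-- At x = 1 the multiplier 1 + q^(2n+1) is the next factor of O⁺, and the added term already
-- contains O⁺ up to that factor, so O⁺ splits off.
shanksSum-𝟙 : ∀ n → shanksSum 𝟙 n 0 n ≈ triangularSeries n ⊗ oddProduct 𝟙 n
shanksSum-𝟙 zero    = ≈-refl
shanksSum-𝟙 (suc n) =
  ≈-trans (shanksSum-suc 𝟙 n)
  (≈-trans (⊕-cong (⊗-congˡ (shanksSum-𝟙 n)) (⊗-congʳ (shanksTerm-𝟙 n (suc n))))
    (solve 5 (λ a o f p h → f :* (a :* o) :+ p :* (o :* f) :* h := (a :+ p :* h) :* (o :* f)) ≈-refl
       (triangularSeries n) (oddProduct 𝟙 n) (𝟙 ⊕ 𝟙 ⊗ (q ⊗ q² ^ n)) ((⊝ (q ⊗ q² ^ n)) ^ suc n) (𝟙 ⊕ q² ^ suc n)))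

-- At x = 0 the multiplier is 1, so the recursion merely accumulates the added terms.
shanksSum-𝟘 : ∀ n → shanksSum 𝟘 n 0 n ≈ pentagonalSeries n
shanksSum-𝟘 zero    = ⊗-identityˡ 𝟙
shanksSum-𝟘 (suc n) =
  ≈-trans (shanksSum-suc 𝟘 n)
    (⊕-cong (≈-trans (⊗-congʳ (≈-trans (⊕-congˡ {𝟙} (⊗-zeroˡ _)) (⊕-identityʳ 𝟙)))
            (≈-trans (⊗-identityˡ _) (shanksSum-𝟘 n)))
            ≈-refl)
-- Congruence modulo q^(N+1)

infix 4 _≈[_]_

record _≈[_]_ (f : PowerSeries) (N : ℕ) (g : PowerSeries) : Set where
  constructor mk≈[]
  field coeff≤ : ∀ m → m ≤ N → f m ≡ g m
open _≈[_]_

≈⇒≈[] : ∀ {f g N} → f ≈ g → f ≈[ N ] g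
≈⇒≈[] p = mk≈[] λ m _ → coeff p m

≈[]-mono : ∀ {f g M N} → M ≤ N → f ≈[ N ] g → f ≈[ M ] g
≈[]-mono M≤N p = mk≈[] λ m m≤M → coeff≤ p m (ℕₚ.≤-trans m≤M M≤N)

≈[]-setoid : ℕ → Setoid _ _
≈[]-setoid N = record
  { Carrier = PowerSeries
  ; _≈_ = λ f g → f ≈[ N ] g
  ; isEquivalence = record
    { refl  = mk≈[] λ _ _ → refl
    ; sym   = λ p → mk≈[] λ m m≤N → sym (coeff≤ p m m≤N)
    ; trans = λ p r → mk≈[] λ m m≤N → trans (coeff≤ p m m≤N) (coeff≤ r m m≤N)
    }
  }

module ≈[] {N} = Setoid (≈[]-setoid N)

⊕-cong[] : ∀ {f f′ g g′ N} → f ≈[ N ] f′ → g ≈[ N ] g′ → f ⊕ g ≈[ N ] f′ ⊕ g′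
⊕-cong[] p r = mk≈[] λ m m≤N → cong₂ _+_ (coeff≤ p m m≤N) (coeff≤ r m m≤N)

⊝-cong[] : ∀ {f g N} → f ≈[ N ] g → ⊝ f ≈[ N ] ⊝ g
⊝-cong[] p = mk≈[] λ m m≤N → cong -_ (coeff≤ p m m≤N)

⊗-cong[] : ∀ {f f′ g g′ N} → f ≈[ N ] f′ → g ≈[ N ] g′ → f ⊗ g ≈[ N ] f′ ⊗ g′
⊗-cong[] p r = mk≈[] λ m m≤N →
  ⊗-cong-at m (λ i i≤m → coeff≤ p i (ℕₚ.≤-trans i≤m m≤N)) (λ i i≤m → coeff≤ r i (ℕₚ.≤-trans i≤m m≤N))

q-⊗-suc : ∀ f n → (q ⊗ f) (suc n) ≡ f n
q-⊗-suc f n = trans (ℤₚ.+-identityˡ _) (coeff (⊗-identityˡ f) n)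

q^-⊗-vanishes : ∀ {N} k f → N < k → q ^ k ⊗ f ≈[ N ] 𝟘
q^-⊗-vanishes k f N<k = mk≈[] λ m m≤N → vanish k m (ℕₚ.≤-<-trans m≤N N<k)
  where
  vanish : ∀ k m → m < k → (q ^ k ⊗ f) m ≡ + 0
  vanish (suc k) zero    _         = refl
  vanish (suc k) (suc m) (s≤s m<k) =
    trans (coeff (⊗-assoc q (q ^ k) f) (suc m)) (trans (q-⊗-suc (q ^ k ⊗ f) m) (vanish k m m<k))

q^-vanishes : ∀ {N} k → N < k → q ^ k ≈[ N ] 𝟘
q^-vanishes k N<k = ≈[].trans (≈⇒≈[] (≈-sym (⊗-identityʳ (q ^ k)))) (q^-⊗-vanishes k 𝟙 N<k)

-- Since u has constant term 1, coefficient n+1 of f ⊗ u is f(n+1) plus a combination of lower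
-- coefficients of f, which agree with those of g by induction.
⊗-cancelʳ[] : ∀ {f g u N} → u 0 ≡ + 1 → f ⊗ u ≈[ N ] g ⊗ u → f ≈[ N ] g
⊗-cancelʳ[] {f} {g} {u} {N} u₀≡1 p = mk≈[] λ m m≤N → agree N ℕₚ.≤-refl m m≤N
  where
  head : ∀ h → h 0 * u 0 ≡ h 0
  head h = trans (cong (h 0 *_) u₀≡1) (ℤₚ.*-identityʳ (h 0))
  last : ∀ h n → (h ⊗ u) (suc n) ≡ (h ⊗ tail u) n + h (suc n)
  last h n = trans (⊗-sucʳ h u n)
    (cong (_+_ ((h ⊗ tail u) n)) (trans (cong (h (suc n) *_) u₀≡1) (ℤₚ.*-identityʳ (h (suc n)))))
  agree : ∀ n → n ≤ N → ∀ m → m ≤ n → f m ≡ g m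
  agree zero    n≤N zero z≤n = trans (sym (head f)) (trans (coeff≤ p 0 n≤N) (head g))
  agree (suc n) n<N m m≤1+n with ℕₚ.m≤n⇒m<n∨m≡n m≤1+n
  ... | inj₁ (s≤s m≤n) = agree n (ℕₚ.<⇒≤ n<N) m m≤n
  ... | inj₂ refl = ∙-cancelˡ ((f ⊗ tail u) n) _ _ (begin
    (f ⊗ tail u) n + f (suc n)  ≡⟨ last f n ⟨
    (f ⊗ u) (suc n)             ≡⟨ coeff≤ p (suc n) n<N ⟩
    (g ⊗ u) (suc n)             ≡⟨ last g n ⟩
    (g ⊗ tail u) n + g (suc n)  ≡⟨ cong (_+ g (suc n)) (⊗-cong-at n (agree n (ℕₚ.<⇒≤ n<N)) (λ _ _ → refl)) ⟨
    (f ⊗ tail u) n + g (suc n)  ∎)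
    where open ≡-Reasoning

-- Products modulo q^(N+1)

prod-cong[] : ∀ {f g N} s k → (∀ j → f (suc j) ≈[ N ] g (suc j)) → prod f (suc s) k ≈[ N ] prod g (suc s) k
prod-cong[] s zero    p = ≈[].refl
prod-cong[] s (suc k) p = ⊗-cong[] (p s) (prod-cong[] (suc s) k p)

prod-⊗ : ∀ f g s k → prod f s k ⊗ prod g s k ≈ prod (λ j → f j ⊗ g j) s k
prod-⊗ f g s zero    = ⊗-identityˡ 𝟙
prod-⊗ f g s (suc k) =
  ≈-trans (solve 4 (λ a b c d → a :* b :* (c :* d) := a :* c :* (b :* d)) ≈-refl
             (f s) (prod f (suc s) k) (g s) (prod g (suc s) k))
          (⊗-congˡ (prod-⊗ f g (suc s) k))

-- Stands in for convergence of the infinite product: the factors past m are 1 modulo q^(m+1).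
prod-stable : ∀ {f} → (∀ j → f (suc j) ≈[ j ] 𝟙) → ∀ {m M} → m ≤ M → prod f 1 M ≈[ m ] prod f 1 m
prod-stable {f} p {m} {M} m≤M =
  subst (λ M → prod f 1 M ≈[ m ] prod f 1 m) (ℕₚ.m+[n∸m]≡n m≤M) (extend (M ℕ.∸ m))
  where
  extend : ∀ d → prod f 1 (m ℕ.+ d) ≈[ m ] prod f 1 m
  extend zero rewrite ℕₚ.+-identityʳ m = ≈[].refl
  extend (suc d) rewrite ℕₚ.+-suc m d =
    ≈[].trans (≈⇒≈[] (prod-snoc f 1 (m ℕ.+ d)))
    (≈[].trans (⊗-cong[] (extend d) (≈[]-mono (ℕₚ.m≤m+n m d) (p (m ℕ.+ d))))
               (≈⇒≈[] (⊗-identityʳ (prod f 1 m))))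

q²^≈ : ∀ n → q² ^ n ≈ q ^ (n ℕ.* 2)
q²^≈ zero    = ≈-refl
q²^≈ (suc n) = ≈-trans (⊗-congˡ (q²^≈ n)) (⊗-assoc q q _)

q-⊗-q²^ : ∀ n → q ⊗ q² ^ n ≈ q ^ suc (n ℕ.* 2)
q-⊗-q²^ n = ⊗-congˡ (q²^≈ n)

n≤n*2 : ∀ n → n ≤ n ℕ.* 2
n≤n*2 n = ℕₚ.m≤m*n n 2

q-⊗-q²^-vanishes : ∀ n → q ⊗ q² ^ n ≈[ n ] 𝟘
q-⊗-q²^-vanishes n = ≈[].trans (≈⇒≈[] (q-⊗-q²^ n)) (q^-vanishes _ (s≤s (n≤n*2 n)))

shanksTerm-vanishes : ∀ x n s → shanksTerm x n (suc s) ≈[ n ] 𝟘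
shanksTerm-vanishes x n s = begin
  u ⊗ (⊝ (q ⊗ q² ^ n) ⊗ b)  ≈⟨ ⊗-cong[] {u} ≈[].refl (⊗-cong[] {g = b} (⊝-cong[] (q-⊗-q²^-vanishes n)) ≈[].refl) ⟩
  u ⊗ (⊝ 𝟘 ⊗ b)             ≈⟨ ≈⇒≈[] (⊗-congˡ (≈-trans (⊗-congʳ {b} ⊝𝟘≈𝟘) (⊗-zeroˡ b))) ⟩
  u ⊗ 𝟘                     ≈⟨ ≈⇒≈[] (⊗-zeroʳ u) ⟩
  𝟘                         ∎
  where
  open SetoidReasoning (≈[]-setoid n)
  u b : PowerSeries
  u = shanksTerm x n s
  b = x ⊕ q ⊗ q² ^ s
  ⊝𝟘≈𝟘 : ⊝ 𝟘 ≈ 𝟘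
  ⊝𝟘≈𝟘 = mk≈ λ _ → refl

shanksSum-vanishes : ∀ x n s r → shanksSum x n (suc s) r ≈[ n ] 𝟘
shanksSum-vanishes x n s zero    =
  ≈[].trans (⊗-cong[] {𝟙} ≈[].refl (shanksTerm-vanishes x n s)) (≈⇒≈[] (⊗-zeroʳ 𝟙))
shanksSum-vanishes x n s (suc r) =
  ⊕-cong[] {g′ = 𝟘}
    (≈[].trans (⊗-cong[] {p} ≈[].refl (shanksTerm-vanishes x n s)) (≈⇒≈[] (⊗-zeroʳ p)))
    (shanksSum-vanishes x n (suc s) r)
  where p = prod evenFactor (suc (suc s)) (suc r)

-- Every summand with s ≥ 1 carries a factor q^(2n+1), so only s = 0 survives, whatever x is.
shanksSum≈[] : ∀ x n → shanksSum x n 0 n ≈[ n ] prod evenFactor 1 n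
shanksSum≈[] x zero    = ≈⇒≈[] (⊗-identityʳ _)
shanksSum≈[] x (suc n) =
  ≈[].trans (⊕-cong[] (≈⇒≈[] (⊗-identityʳ p)) (shanksSum-vanishes x (suc n) 0 n)) (≈⇒≈[] (⊕-identityʳ p))
  where p = prod evenFactor 1 (suc n)

-- Gauss's identity T O⁺ = E to order n.
triangularSeries-product : ∀ n → triangularSeries n ⊗ oddProduct 𝟙 n ≈[ n ] prod evenFactor 1 n
triangularSeries-product n = ≈[].trans (≈⇒≈[] (≈-sym (shanksSum-𝟙 n))) (shanksSum≈[] 𝟙 n)

-- Euler's pentagonal number theorem with q² in place of q, to order n.
pentagonalSeries-product : ∀ n → pentagonalSeries n ≈[ n ] prod evenFactor 1 n
pentagonalSeries-product n = ≈[].trans (≈⇒≈[] (≈-sym (shanksSum-𝟘 n))) (shanksSum≈[] 𝟘 n)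

evenFactor-stable : ∀ j → evenFactor (suc j) ≈[ j ] 𝟙
evenFactor-stable j =
  ≈[].trans (⊕-cong[] {𝟙} ≈[].refl (⊝-cong[] (≈[].trans (≈⇒≈[] (q²^≈ (suc j))) (q^-vanishes _ (n≤n*2 (suc j))))))
            (≈⇒≈[] (⊕-identityʳ 𝟙))

-- The factors 1 ± q^j and their sorting by parity

linearFactor : PowerSeries → ℕ → PowerSeries
linearFactor ε j = 𝟙 ⊕ ε ⊗ q ^ j

linearFactor-stable : ∀ ε j → linearFactor ε (suc j) ≈[ j ] 𝟙
linearFactor-stable ε j =
  ≈[].trans (⊕-cong[] {𝟙} ≈[].refl (⊗-cong[] {ε} ≈[].refl (q^-vanishes (suc j) ℕₚ.≤-refl)))
            (≈⇒≈[] (≈-trans (⊕-congˡ {𝟙} (⊗-zeroʳ ε)) (⊕-identityʳ 𝟙)))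

linearFactor-± : ∀ j → linearFactor 𝟙 j ⊗ linearFactor (⊝ 𝟙) j ≈ evenFactor j
linearFactor-± j =
  ≈-trans (solve 1 (λ a → (one :+ one :* a) :* (one :+ :- one :* a) := one :- a :* a) ≈-refl (q ^ j))
          (≈-sym (⊕-congˡ {𝟙} (⊝-cong (^-distrib-* q q j))))
  where one = con (+ 1)

-- Odd and even exponents up to 2n interleave. Multiplying by ∏ (1 + q^j) over j ≤ 2n then turns the
-- right side into ∏ (1 - q^(2j)), which yields D O⁻ E = E to order n.
oddProduct-⊗-evenProduct : ∀ n →
  oddProduct (⊝ 𝟙) n ⊗ prod evenFactor 1 n ≈ prod (linearFactor (⊝ 𝟙)) 1 (n ℕ.* 2)
oddProduct-⊗-evenProduct zero    = ⊗-identityˡ 𝟙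
oddProduct-⊗-evenProduct (suc n) = begin
  o ⊗ (𝟙 ⊕ ⊝ 𝟙 ⊗ (q ⊗ q² ^ n)) ⊗ prod evenFactor 1 (suc n)
    ≈⟨ ⊗-cong (⊗-congˡ (⊕-congˡ {𝟙} (⊗-congˡ (q-⊗-q²^ n)))) (prod-snoc evenFactor 1 n) ⟩
  o ⊗ l₁ ⊗ (e ⊗ evenFactor (suc n))
    ≈⟨ ⊗-congˡ (⊗-congˡ (⊕-congˡ {𝟙} (⊝-cong (q²^≈ (suc n))))) ⟩
  o ⊗ l₁ ⊗ (e ⊗ (𝟙 ⊕ ⊝ (q ^ suc (suc (n ℕ.* 2)))))
    ≈⟨ solve 4 (λ o l e a → o :* l :* (e :* (one :- a)) := o :* e :* l :* (one :+ :- one :* a)) ≈-refl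
         o l₁ e (q ^ suc (suc (n ℕ.* 2))) ⟩
  o ⊗ e ⊗ l₁ ⊗ l₂
    ≈⟨ ⊗-congʳ (⊗-congʳ (oddProduct-⊗-evenProduct n)) ⟩
  prod (linearFactor (⊝ 𝟙)) 1 (n ℕ.* 2) ⊗ l₁ ⊗ l₂
    ≈⟨ ⊗-congʳ (prod-snoc (linearFactor (⊝ 𝟙)) 1 (n ℕ.* 2)) ⟨
  prod (linearFactor (⊝ 𝟙)) 1 (suc (n ℕ.* 2)) ⊗ l₂
    ≈⟨ prod-snoc (linearFactor (⊝ 𝟙)) 1 (suc (n ℕ.* 2)) ⟨
  prod (linearFactor (⊝ 𝟙)) 1 (suc (suc (n ℕ.* 2))) ∎
  where
  open SetoidReasoning setoid
  one = con (+ 1)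
  o e l₁ l₂ : PowerSeries
  o  = oddProduct (⊝ 𝟙) n
  e  = prod evenFactor 1 n
  l₁ = linearFactor (⊝ 𝟙) (suc (n ℕ.* 2))
  l₂ = linearFactor (⊝ 𝟙) (suc (suc (n ℕ.* 2)))

-- Padded with 1 at even j, because the encoding of overpartitions has an entry for every part size.
oddFactor : PowerSeries → ℕ → PowerSeries
oddFactor ε j = if isOdd j then linearFactor ε j else 𝟙

oddFactor-stable : ∀ ε j → oddFactor ε (suc j) ≈[ j ] 𝟙
oddFactor-stable ε j with isOdd (suc j)
... | true  = linearFactor-stable ε j
... | false = ≈[].refl

isOdd-2+ : ∀ j → isOdd (suc (suc j)) ≡ isOdd j
isOdd-2+ j = cong (ℕ._≡ᵇ 1) (trans (cong (ℕ._% 2) (ℕₚ.+-comm 2 j)) ([m+n]%n≡m%n j 2))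

isOdd-odd : ∀ n → isOdd (suc (n ℕ.* 2)) ≡ true
isOdd-odd zero    = refl
isOdd-odd (suc n) = trans (isOdd-2+ (suc (n ℕ.* 2))) (isOdd-odd n)

isOdd-even : ∀ n → isOdd (n ℕ.* 2) ≡ false
isOdd-even zero    = refl
isOdd-even (suc n) = trans (isOdd-2+ (n ℕ.* 2)) (isOdd-even n)

prod-oddFactor : ∀ ε n → prod (oddFactor ε) 1 (n ℕ.* 2) ≈ oddProduct ε n
prod-oddFactor ε zero    = ≈-refl
prod-oddFactor ε (suc n) =
  ≈-trans (prod-snoc (oddFactor ε) 1 (suc (n ℕ.* 2)))
  (≈-trans (⊗-cong (prod-snoc (oddFactor ε) 1 (n ℕ.* 2)) even)
  (≈-trans (⊗-identityʳ _)
           (⊗-cong (prod-oddFactor ε n) odd)))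
  where
  even : oddFactor ε (suc n ℕ.* 2) ≈ 𝟙
  even rewrite isOdd-even (suc n) = ≈-refl
  odd : oddFactor ε (suc (n ℕ.* 2)) ≈ 𝟙 ⊕ ε ⊗ (q ⊗ q² ^ n)
  odd rewrite isOdd-odd n = ⊕-congˡ {𝟙} (⊗-congˡ (≈-sym (q-⊗-q²^ n)))

oddProduct-0 : ∀ ε n → oddProduct ε n 0 ≡ + 1
oddProduct-0 ε zero    = refl
oddProduct-0 ε (suc n) =
  cong₂ _*_ (oddProduct-0 ε n) (cong (_+_ (+ 1)) (ℤₚ.*-zeroʳ (ε 0)))
-- Generating functions of weighted lists

q^-coeff : ∀ k n → (q ^ k) n ≡ (if k ℕ.≡ᵇ n then + 1 else + 0)
q^-coeff zero    zero    = refl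
q^-coeff zero    (suc n) = refl
q^-coeff (suc k) zero    = refl
q^-coeff (suc k) (suc n) = trans (q-⊗-suc (q ^ k) n) (q^-coeff k n)

module _ {A : Set} where

  term : (A → Bool) → (A → ℕ) → A → PowerSeries
  term v w a = if v a then q ^ w a else 𝟘

  gf : (A → Bool) → (A → ℕ) → List A → PowerSeries
  gf v w []       = 𝟘
  gf v w (a ∷ as) = term v w a ⊕ gf v w as

  gf-coeff : ∀ v w as n → gf v w as n ≡ + length (filterᵇ (λ a → v a ∧ (w a ℕ.≡ᵇ n)) as)
  gf-coeff v w []       n = refl
  gf-coeff v w (a ∷ as) n with v a
  ... | false = trans (ℤₚ.+-identityˡ _) (gf-coeff v w as n)
  ... | true with w a ℕ.≡ᵇ n | q^-coeff (w a) n
  ...   | true  | eq = cong₂ _+_ eq (gf-coeff v w as n)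
  ...   | false | eq = trans (cong₂ _+_ eq (gf-coeff v w as n)) (ℤₚ.+-identityˡ _)

  gf-++ : ∀ v w as bs → gf v w (as ++ bs) ≈ gf v w as ⊕ gf v w bs
  gf-++ v w []       bs = ≈-sym (⊕-identityˡ _)
  gf-++ v w (a ∷ as) bs =
    ≈-trans (⊕-congˡ {term v w a} (gf-++ v w as bs))
            (≈-sym (⊕-assoc (term v w a) (gf v w as) (gf v w bs)))

module _ {A B C : Set} (c : A → B → C)
  {v : C → Bool} {v₁ : A → Bool} {v₂ : B → Bool} (v-c : ∀ a b → v (c a b) ≡ v₁ a ∧ v₂ b)
  {w : C → ℕ} {w₁ : A → ℕ} {w₂ : B → ℕ} (w-c : ∀ a b → w (c a b) ≡ w₁ a ℕ.+ w₂ b) where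

  term-⊗ : ∀ a b → term v w (c a b) ≈ term v₁ w₁ a ⊗ term v₂ w₂ b
  term-⊗ a b rewrite v-c a b | w-c a b with v₁ a | v₂ b
  ... | false | _     = ≈-sym (⊗-zeroˡ _)
  ... | true  | false = ≈-sym (⊗-zeroʳ (q ^ w₁ a))
  ... | true  | true  = ^-homo-* q (w₁ a) (w₂ b)

  gf-map : ∀ a bs → gf v w (map (c a) bs) ≈ term v₁ w₁ a ⊗ gf v₂ w₂ bs
  gf-map a []       = ≈-sym (⊗-zeroʳ (term v₁ w₁ a))
  gf-map a (b ∷ bs) =
    ≈-trans (⊕-cong (term-⊗ a b) (gf-map a bs))
            (≈-sym (⊗-distribˡ (term v₁ w₁ a) (term v₂ w₂ b) (gf v₂ w₂ bs)))

  -- Validity is a conjunction and weight a sum over the two components, so the sum over all pairs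
  -- factors.
  gf-concatMap : ∀ as bs → gf v w (concatMap (λ a → map (c a) bs) as) ≈ gf v₁ w₁ as ⊗ gf v₂ w₂ bs
  gf-concatMap []       bs = ≈-sym (⊗-zeroˡ (gf v₂ w₂ bs))
  gf-concatMap (a ∷ as) bs =
    ≈-trans (gf-++ v w (map (c a) bs) _)
    (≈-trans (⊕-cong (gf-map a bs) (gf-concatMap as bs))
             (≈-sym (⊗-distribʳ (gf v₂ w₂ bs) (term v₁ w₁ a) (gf v₁ w₁ as))))

-- Generating functions of distinct partitions and of overpartitions into odd parts

gf-distinct : ∀ s k → gf (λ _ → true) (dsum s) (vecsOver (true ∷ false ∷ []) k) ≈ prod (linearFactor 𝟙) s k
gf-distinct s zero    = ⊕-identityʳ 𝟙
gf-distinct s (suc k) =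
  ≈-trans (gf-concatMap _∷_ (λ _ _ → refl) {w₁ = λ b → if b then s else 0} (λ _ _ → refl)
             (true ∷ false ∷ []) (vecsOver (true ∷ false ∷ []) k))
          (⊗-cong factor (gf-distinct (suc s) k))
  where
  factor : q ^ s ⊕ (𝟙 ⊕ 𝟘) ≈ linearFactor 𝟙 s
  factor = ≈-trans (⊕-congˡ {q ^ s} (⊕-identityʳ 𝟙))
                   (solve 1 (λ a → a :+ con (+ 1) := con (+ 1) :+ con (+ 1) :* a) ≈-refl (q ^ s))

-- The contribution of part size s with multiplicity at most b: for odd s a truncation of (1 +
-- q^s)/(1 - q^s), for even s just 1.
entrySeries : ℕ → ℕ → PowerSeries
entrySeries b s = gf (λ e → oValid s (e ∷ [])) (λ e → s ℕ.* proj₁ e) (entries b)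

∧-insert-true : ∀ x y z → x ∧ y ∧ z ≡ (x ∧ y ∧ true) ∧ z
∧-insert-true true  true  z = refl
∧-insert-true true  false z = refl
∧-insert-true false y     z = refl

oValid-∷ : ∀ s e {k} (es : Vec (ℕ × Bool) k) → oValid s (e ∷ es) ≡ oValid s (e ∷ []) ∧ oValid (suc s) es
oValid-∷ s (m , o) es with isOdd s | o
... | true  | true  = ∧-insert-true true (1 ℕ.≤ᵇ m) (oValid (suc s) es)
... | true  | false = refl
... | false | true  = ∧-insert-true (m ℕ.≡ᵇ 0) (1 ℕ.≤ᵇ m) (oValid (suc s) es)
... | false | false = ∧-insert-true (m ℕ.≡ᵇ 0) true (oValid (suc s) es)

gf-overpartition : ∀ b s k → gf (oValid s) (osum s) (vecsOver (entries b) k) ≈ prod (entrySeries b) s k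
gf-overpartition b s zero    = ⊕-identityʳ 𝟙
gf-overpartition b s (suc k) =
  ≈-trans (gf-concatMap _∷_ {v₁ = λ e → oValid s (e ∷ [])} (λ e → oValid-∷ s e) {w₁ = λ e → s ℕ.* proj₁ e} (λ _ _ → refl)
             (entries b) (vecsOver (entries b) k))
          (⊗-congˡ (gf-overpartition b (suc s) k))
entries-suc : ∀ b → entries (suc b) ≡ entries b ++ (suc b , true) ∷ (suc b , false) ∷ []
entries-suc b =
  trans (cong (concatMap both) (sym (upTo-∷ʳ (suc b)))) (concatMap-++ both (range0 b) (suc b ∷ []))
  where
  both : ℕ → List (ℕ × Bool)
  both m = (m , true) ∷ (m , false) ∷ []

entrySeries-suc : ∀ b s → entrySeries (suc b) s
  ≈ entrySeries b s ⊕ gf (λ e → oValid s (e ∷ [])) (λ e → s ℕ.* proj₁ e) ((suc b , true) ∷ (suc b , false) ∷ [])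
entrySeries-suc b s =
  subst (λ es → gf v w es ≈ entrySeries b s ⊕ gf v w new) (sym (entries-suc b)) (gf-++ v w (entries b) new)
  where
  v : ℕ × Bool → Bool
  v e = oValid s (e ∷ [])
  w : ℕ × Bool → ℕ
  w e = s ℕ.* proj₁ e
  new : List (ℕ × Bool)
  new = (suc b , true) ∷ (suc b , false) ∷ []

entrySeries-even : ∀ b s → isOdd s ≡ false → entrySeries b s ≈ 𝟙
entrySeries-even zero    s even rewrite even | ℕₚ.*-zeroʳ s = ≈-trans (⊕-identityˡ _) (⊕-identityʳ 𝟙)
entrySeries-even (suc b) s even = ≈-trans (entrySeries-suc b s) (≈-trans (⊕-cong (entrySeries-even b s even) none) (⊕-identityʳ 𝟙))
  where
  none : gf (λ e → oValid s (e ∷ [])) (λ e → s ℕ.* proj₁ e) ((suc b , true) ∷ (suc b , false) ∷ []) ≈ 𝟘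
  none rewrite even = ≈-trans (⊕-identityˡ _) (⊕-identityˡ 𝟘)

-- Multiplicity 0 admits no overline and each m ≥ 1 admits both flags, so the series is 1 + 2
-- Σ_{1≤m≤b} q^(sm); the factor 1 - q^s telescopes it up to the truncation term.
entrySeries-odd : ∀ b s → isOdd s ≡ true →
  entrySeries b s ⊗ linearFactor (⊝ 𝟙) s ≈ linearFactor 𝟙 s ⊕ ⊝ (q ^ (s ℕ.* suc b) ⊕ q ^ (s ℕ.* suc b))
entrySeries-odd zero    s odd rewrite odd | ℕₚ.*-zeroʳ s | ℕₚ.*-identityʳ s =
  ≈-trans (⊗-congʳ (≈-trans (⊕-identityˡ _) (⊕-identityʳ 𝟙)))
    (solve 1 (λ a → one :* (one :+ :- one :* a) := one :+ one :* a :- (a :+ a)) ≈-refl (q ^ s))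
  where one = con (+ 1)
entrySeries-odd (suc b) s odd = begin
  entrySeries (suc b) s ⊗ l⁻              ≈⟨ ⊗-congʳ (entrySeries-suc b s) ⟩
  (entrySeries b s ⊕ new) ⊗ l⁻            ≈⟨ ⊗-congʳ (⊕-congˡ {entrySeries b s} new≈) ⟩
  (entrySeries b s ⊕ (a ⊕ a)) ⊗ l⁻        ≈⟨ ⊗-distribʳ l⁻ (entrySeries b s) (a ⊕ a) ⟩
  entrySeries b s ⊗ l⁻ ⊕ (a ⊕ a) ⊗ l⁻     ≈⟨ ⊕-congʳ (entrySeries-odd b s odd) ⟩
  l⁺ ⊕ ⊝ (a ⊕ a) ⊕ (a ⊕ a) ⊗ l⁻           ≈⟨ solve 3 (λ l a x → l :- (a :+ a) :+ (a :+ a) :* (con (+ 1) :+ :- con (+ 1) :* x)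
                                                        := l :- (x :* a :+ x :* a)) ≈-refl l⁺ a (q ^ s) ⟩
  l⁺ ⊕ ⊝ (q ^ s ⊗ a ⊕ q ^ s ⊗ a)          ≈⟨ ⊕-congˡ {l⁺} (⊝-cong (⊕-cong next next)) ⟨
  l⁺ ⊕ ⊝ (q ^ (s ℕ.* suc (suc b)) ⊕ q ^ (s ℕ.* suc (suc b))) ∎
  where
  open SetoidReasoning setoid
  l⁺ l⁻ a new : PowerSeries
  l⁺ = linearFactor 𝟙 s
  l⁻ = linearFactor (⊝ 𝟙) s
  a = q ^ (s ℕ.* suc b)
  new = gf (λ e → oValid s (e ∷ [])) (λ e → s ℕ.* proj₁ e) ((suc b , true) ∷ (suc b , false) ∷ [])
  new≈ : new ≈ a ⊕ a
  new≈ rewrite odd = ⊕-congˡ {a} (⊕-identityʳ a)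
  next : q ^ (s ℕ.* suc (suc b)) ≈ q ^ s ⊗ a
  next rewrite ℕₚ.*-suc s (suc b) = ^-homo-* q s (s ℕ.* suc b)

entrySeries-oddFactor : ∀ b j → entrySeries b (suc j) ⊗ oddFactor (⊝ 𝟙) (suc j) ≈[ b ] oddFactor 𝟙 (suc j)
entrySeries-oddFactor b j = parity (isOdd (suc j)) refl
  where
  l⁺ l⁻ : PowerSeries
  l⁺ = linearFactor 𝟙 (suc j)
  l⁻ = linearFactor (⊝ 𝟙) (suc j)
  -- The truncation error has exponent (j+1)(b+1) > b, beyond the precision kept.
  vanish : q ^ (suc j ℕ.* suc b) ≈[ b ] 𝟘
  vanish = q^-vanishes _ (ℕₚ.m≤n*m (suc b) (suc j))
  parity : ∀ p → isOdd (suc j) ≡ p →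
           entrySeries b (suc j) ⊗ (if p then l⁻ else 𝟙) ≈[ b ] (if p then l⁺ else 𝟙)
  parity false even = ≈⇒≈[] (≈-trans (⊗-identityʳ (entrySeries b (suc j))) (entrySeries-even b (suc j) even))
  parity true  odd  = ≈[].trans (≈⇒≈[] (entrySeries-odd b (suc j) odd))
    (≈[].trans (⊕-cong[] {l⁺} ≈[].refl (⊝-cong[] {g = 𝟘} (⊕-cong[] {g′ = 𝟘} vanish vanish)))
               (≈⇒≈[] (⊕-identityʳ l⁺)))

distinctSeries overpartitionSeries : PowerSeries
distinctSeries      n = + pd n
overpartitionSeries n = + pobar n

distinctSeries-product : ∀ {n M} → n ≤ M → distinctSeries ≈[ n ] prod (linearFactor 𝟙) 1 M
distinctSeries-product {n} {M} n≤M = mk≈[] λ m m≤n →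
  trans (sym (gf-coeff (λ _ → true) (dsum 1) (vecsOver (true ∷ false ∷ []) m) m))
  (trans (coeff (gf-distinct 1 m) m)
         (sym (coeff≤ (prod-stable (linearFactor-stable 𝟙) (ℕₚ.≤-trans m≤n n≤M)) m ℕₚ.≤-refl)))

entryProduct : ∀ {m n} → m ≤ n → prod (entrySeries m) 1 m ⊗ oddProduct (⊝ 𝟙) n ≈[ m ] oddProduct 𝟙 n
entryProduct {m} {n} m≤n = begin
  e ⊗ oddProduct (⊝ 𝟙) n                                       ≈⟨ ⊗-cong[] {e} ≈[].refl (oddProduct≈[] (⊝ 𝟙)) ⟩
  e ⊗ prod (oddFactor (⊝ 𝟙)) 1 m                               ≈⟨ ≈⇒≈[] (prod-⊗ (entrySeries m) (oddFactor (⊝ 𝟙)) 1 m) ⟩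
  prod (λ j → entrySeries m j ⊗ oddFactor (⊝ 𝟙) j) 1 m         ≈⟨ prod-cong[] 0 m (entrySeries-oddFactor m) ⟩
  prod (oddFactor 𝟙) 1 m                                       ≈⟨ oddProduct≈[] 𝟙 ⟨
  oddProduct 𝟙 n                                               ∎
  where
  open SetoidReasoning (≈[]-setoid m)
  e : PowerSeries
  e = prod (entrySeries m) 1 m
  oddProduct≈[] : ∀ ε → oddProduct ε n ≈[ m ] prod (oddFactor ε) 1 m
  oddProduct≈[] ε = ≈[].trans (≈⇒≈[] (≈-sym (prod-oddFactor ε n)))
                              (prod-stable (oddFactor-stable ε) (ℕₚ.≤-trans m≤n (n≤n*2 n)))

overpartitionSeries-product : ∀ n → overpartitionSeries ⊗ oddProduct (⊝ 𝟙) n ≈[ n ] oddProduct 𝟙 n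
overpartitionSeries-product n = ≈[].trans (⊗-cong[] {g = oddProduct (⊝ 𝟙) n} series≈ ≈[].refl) (entryProduct ℕₚ.≤-refl)
  where
  series≈ : overpartitionSeries ≈[ n ] prod (entrySeries n) 1 n
  series≈ = mk≈[] λ m m≤n →
    trans (sym (gf-coeff (oValid 1) (osum 1) (vecsOver (entries m) m) m))
    (trans (coeff (gf-overpartition m 1 m) m)
           -- The encoding bounds both length and multiplicities by m, so the product changes with
           -- the coefficient. Modulo q^(m+1) the versions for m and n agree, since each times O⁻ is
           -- O⁺ and O⁻ cancels.
           (coeff≤ (⊗-cancelʳ[] (oddProduct-0 (⊝ 𝟙) n)
                     (≈[].trans (entryProduct m≤n) (≈[].sym (≈[]-mono m≤n (entryProduct ℕₚ.≤-refl)))))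
                   m ℕₚ.≤-refl))
-- Extraction of coefficients

module Extraction (p : ℕ → ℕ) (n : ℕ) where

  series : PowerSeries
  series m = + p m

  -- Multiplication by q^e shifts coefficients, and the zeros it inserts below q^e match the value 0
  -- of `atℤ` at negative arguments.
  q^-⊗-series : ∀ e → (q ^ e ⊗ series) n ≡ atℤ p (+ n - + e)
  q^-⊗-series e = trans (shift e n) (cong (atℤ p) (sym (ℤₚ.m-n≡m⊖n n e)))
    where
    shift : ∀ e m → (q ^ e ⊗ series) m ≡ atℤ p (m ℤ.⊖ e)
    shift zero    m       = coeff (⊗-identityˡ series) m
    shift (suc e) zero    = refl
    shift (suc e) (suc m) =
      trans (coeff (⊗-assoc q (q ^ e) series) (suc m))
      (trans (q-⊗-suc (q ^ e ⊗ series) m)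
      (trans (shift e m) (cong (atℤ p) (sym (ℤₚ.[1+m]⊖[1+n]≡m⊖n m e)))))

  monomial-⊗-series : ∀ a e → (constant a ⊗ q ^ e ⊗ series) n ≡ a * atℤ p (+ n - + e)
  monomial-⊗-series a e =
    trans (coeff (⊗-assoc (constant a) (q ^ e) series) n)
    (trans (constant-⊗ a (q ^ e ⊗ series) n) (cong (a *_) (q^-⊗-series e)))

  atℤ-vanishes : ∀ {e} → n < e → atℤ p (+ n - + e) ≡ + 0
  atℤ-vanishes {e} n<e = trans (sym (q^-⊗-series e)) (coeff≤ (q^-⊗-vanishes e series n<e) n ℕₚ.≤-refl)

  add-monomials : ∀ {f g} a e e′ → g ≈ constant a ⊗ q ^ e ⊕ constant a ⊗ q ^ e′ →
    ((f ⊕ g) ⊗ series) n ≡ (f ⊗ series) n + (a * atℤ p (+ n - + e) + a * atℤ p (+ n - + e′))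
  add-monomials {f} {g} a e e′ g≈ = begin
    ((f ⊕ g) ⊗ series) n
      ≡⟨ ⊗-distribʳ-at n series f g ⟩
    (f ⊗ series) n + (g ⊗ series) n
      ≡⟨ cong (_+_ ((f ⊗ series) n)) (coeff (⊗-congʳ g≈) n) ⟩
    (f ⊗ series) n + ((constant a ⊗ q ^ e ⊕ constant a ⊗ q ^ e′) ⊗ series) n
      ≡⟨ cong (_+_ ((f ⊗ series) n)) (⊗-distribʳ-at n series (constant a ⊗ q ^ e) (constant a ⊗ q ^ e′)) ⟩
    (f ⊗ series) n + ((constant a ⊗ q ^ e ⊗ series) n + (constant a ⊗ q ^ e′ ⊗ series) n)
      ≡⟨ cong (_+_ ((f ⊗ series) n)) (cong₂ _+_ (monomial-⊗-series a e) (monomial-⊗-series a e′)) ⟩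
    (f ⊗ series) n + (a * atℤ p (+ n - + e) + a * atℤ p (+ n - + e′)) ∎
    where open ≡-Reasoning

monomial-⊗ : ∀ a {f} e d → f ≈ constant a ⊗ q ^ e →
  f ⊗ (𝟙 ⊕ q² ^ d) ≈ constant a ⊗ q ^ e ⊕ constant a ⊗ q ^ (e ℕ.+ d ℕ.* 2)
monomial-⊗ a {f} e d f≈ =
  ≈-trans (⊗-cong f≈ (⊕-congˡ {𝟙} (q²^≈ d)))
  (≈-trans (solve 3 (λ c x y → c :* x :* (con (+ 1) :+ y) := c :* x :+ c :* (x :* y)) ≈-refl
              (constant a) (q ^ e) (q ^ (d ℕ.* 2)))
           (⊕-congˡ {constant a ⊗ q ^ e} (⊗-congˡ (≈-sym (^-homo-* q e (d ℕ.* 2))))))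

⊝-constant : ∀ a → ⊝ constant a ≈ constant (- a)
⊝-constant a = mk≈ λ { zero → refl ; (suc n) → refl }

⊝-^ : ∀ f s → (⊝ f) ^ s ≈ constant (sgn s) ⊗ f ^ s
⊝-^ f zero    = ≈-sym (⊗-identityˡ 𝟙)
⊝-^ f (suc s) =
  ≈-trans (⊗-congˡ (⊝-^ f s))
  (≈-trans (solve 3 (λ f c g → :- f :* (c :* g) := :- c :* (f :* g)) ≈-refl f (constant (sgn s)) (f ^ s))
           (⊗-congʳ (⊝-constant (sgn s))))

triangularMonomial : ∀ n → (⊝ (q ⊗ q² ^ n)) ^ suc n ≈ constant (sgn (suc n)) ⊗ q ^ (suc (n ℕ.* 2) ℕ.* suc n)
triangularMonomial n =
  ≈-trans (⊝-^ (q ⊗ q² ^ n) (suc n))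
          (⊗-congˡ (≈-trans (^-congˡ (suc n) (q-⊗-q²^ n)) (^-assocʳ q (suc (n ℕ.* 2)) (suc n))))

pentagonalMonomial : ∀ n s → shanksTerm 𝟘 n s ≈ constant (sgn s) ⊗ q ^ pentagonalExponent n s
pentagonalMonomial n zero    = ≈-sym (⊗-identityˡ 𝟙)
pentagonalMonomial n (suc s) =
  ≈-trans (⊗-cong (pentagonalMonomial n s)
                  (⊗-cong (⊝-cong (q-⊗-q²^ n)) (≈-trans (⊕-identityˡ _) (q-⊗-q²^ s))))
  (≈-trans (solve 4 (λ c x y z → c :* x :* (:- y :* z) := :- c :* (x :* (y :* z))) ≈-refl
              (constant (sgn s)) (q ^ e) (q ^ suc (n ℕ.* 2)) (q ^ suc (s ℕ.* 2)))
           (⊗-cong (⊝-constant (sgn s)) exponents))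
  where
  e : ℕ
  e = pentagonalExponent n s
  exponents : q ^ e ⊗ (q ^ suc (n ℕ.* 2) ⊗ q ^ suc (s ℕ.* 2)) ≈ q ^ pentagonalExponent n (suc s)
  exponents =
    ≈-trans (⊗-congˡ (≈-sym (^-homo-* q (suc (n ℕ.* 2)) (suc (s ℕ.* 2)))))
    (≈-trans (≈-sym (^-homo-* q e _))
             (^-congʳ q (pentagonalExponent-suc n s)))

-- The pair added at step j+1 has indices 2j+1 and 2j+2, which share the value j+1 of `ceilHalf` and
-- hence the sign.
triangularSum : ∀ p n j → (triangularSeries j ⊗ Extraction.series p n) n
  ≡ sumTo (j ℕ.* 2) (λ k → sgn (ceilHalf k) * atℤ p (+ n - + tri k))
triangularSum p n zero    =
  trans (coeff (⊗-identityˡ (Extraction.series p n)) n)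
        (sym (trans (ℤₚ.*-identityˡ _) (cong (atℤ p) (ℤₚ.+-identityʳ (+ n)))))
triangularSum p n (suc j) = begin
  (triangularSeries (suc j) ⊗ series) n
    ≡⟨ add-monomials (sgn (suc j)) e₁ e₂ (monomial-⊗ (sgn (suc j)) e₁ (suc j) (triangularMonomial j)) ⟩
  (triangularSeries j ⊗ series) n + (sgn (suc j) * atℤ p (+ n - + e₁) + sgn (suc j) * atℤ p (+ n - + e₂))
    ≡⟨ cong₂ _+_ (triangularSum p n j) (cong₂ _+_ summand-odd summand-even) ⟩
  sumTo (j ℕ.* 2) g + (g (suc (j ℕ.* 2)) + g (suc j ℕ.* 2))
    ≡⟨ ℤₚ.+-assoc (sumTo (j ℕ.* 2) g) _ _ ⟨
  sumTo (suc j ℕ.* 2) g ∎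
  where
  open ≡-Reasoning
  open Extraction p n
  e₁ e₂ : ℕ
  e₁ = suc (j ℕ.* 2) ℕ.* suc j
  e₂ = e₁ ℕ.+ suc j ℕ.* 2
  g : ℕ → ℤ
  g k = sgn (ceilHalf k) * atℤ p (+ n - + tri k)
  summand-odd : sgn (suc j) * atℤ p (+ n - + e₁) ≡ g (suc (j ℕ.* 2))
  summand-odd = sym (cong₂ (λ c t → sgn c * atℤ p (+ n - + t)) (ceilHalf-odd j) (tri-odd j))
  summand-even : sgn (suc j) * atℤ p (+ n - + e₂) ≡ g (suc j ℕ.* 2)
  summand-even = sym (cong₂ (λ c t → sgn c * atℤ p (+ n - + t)) (ceilHalf-even (suc j)) (tri-even j))

pentagonalSum : ∀ p n j → (pentagonalSeries j ⊗ Extraction.series p n) n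
  ≡ sumSym j (λ k → sgnℤ k * atℤ p (+ n - k * (+ 3 * k + + 1)))
pentagonalSum p n zero    =
  trans (coeff (⊗-identityˡ (Extraction.series p n)) n)
        (sym (trans (ℤₚ.*-identityˡ _) (cong (atℤ p) (ℤₚ.+-identityʳ (+ n)))))
pentagonalSum p n (suc j) = begin
  (pentagonalSeries (suc j) ⊗ series) n
    ≡⟨ add-monomials (sgn (suc j)) e₁ e₂ (monomial-⊗ (sgn (suc j)) e₁ (suc j) (pentagonalMonomial j (suc j))) ⟩
  (pentagonalSeries j ⊗ series) n + (sgn (suc j) * atℤ p (+ n - + e₁) + sgn (suc j) * atℤ p (+ n - + e₂))
    ≡⟨ cong₂ _+_ (pentagonalSum p n j)
         (cong₂ (λ x y → sgn (suc j) * atℤ p (+ n - x) + sgn (suc j) * atℤ p (+ n - y))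
                (pentagonalExponent-negative j) (pentagonalExponent-positive j)) ⟩
  sumSym j h + (h ℤ.-[1+ j ] + h (+ suc j))
    ≡⟨ sumSym-suc j h ⟨
  sumSym (suc j) h ∎
  where
  open ≡-Reasoning
  open Extraction p n
  e₁ e₂ : ℕ
  e₁ = pentagonalExponent j (suc j)
  e₂ = e₁ ℕ.+ suc j ℕ.* 2
  h : ℤ → ℤ
  h k = sgnℤ k * atℤ p (+ n - k * (+ 3 * k + + 1))

-- Comparison of the two sides to order n, by cancelling O⁻

triangular-pentagonal : ∀ n →
  triangularSeries n ⊗ overpartitionSeries ≈[ n ] pentagonalSeries n ⊗ distinctSeries
triangular-pentagonal n = ⊗-cancelʳ[] (oddProduct-0 (⊝ 𝟙) n) (begin
  (t ⊗ overpartitionSeries) ⊗ o⁻  ≈⟨ ≈⇒≈[] (⊗-assoc t overpartitionSeries o⁻) ⟩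
  t ⊗ (overpartitionSeries ⊗ o⁻)  ≈⟨ ⊗-cong[] {t} ≈[].refl (overpartitionSeries-product n) ⟩
  t ⊗ oddProduct 𝟙 n              ≈⟨ triangularSeries-product n ⟩
  -- Lengthening E from n to 2n factors, harmless modulo q^(n+1), matches the range in which the odd
  -- and even exponents interleave.
  e                               ≈⟨ prod-stable evenFactor-stable (n≤n*2 n) ⟨
  prod evenFactor 1 M             ≈⟨ prod-cong[] 0 M (λ j → ≈⇒≈[] (linearFactor-± (suc j))) ⟨
  prod (λ j → linearFactor 𝟙 j ⊗ linearFactor (⊝ 𝟙) j) 1 M
                                  ≈⟨ ≈⇒≈[] (prod-⊗ (linearFactor 𝟙) (linearFactor (⊝ 𝟙)) 1 M) ⟨
  d ⊗ prod (linearFactor (⊝ 𝟙)) 1 M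
                                  ≈⟨ ≈⇒≈[] (⊗-congˡ (oddProduct-⊗-evenProduct n)) ⟨
  d ⊗ (o⁻ ⊗ e)                    ≈⟨ ≈⇒≈[] (solve 3 (λ d o e → d :* (o :* e) := e :* d :* o) ≈-refl d o⁻ e) ⟩
  (e ⊗ d) ⊗ o⁻                    ≈⟨ ⊗-cong[] {g = o⁻} (⊗-cong[] (pentagonalSeries-product n) (distinctSeries-product (n≤n*2 n))) ≈[].refl ⟨
  (pentagonalSeries n ⊗ distinctSeries) ⊗ o⁻ ∎)
  where
  open SetoidReasoning (≈[]-setoid n)
  M : ℕ
  M = n ℕ.* 2
  t e d o⁻ : PowerSeries
  t  = triangularSeries n
  e  = prod evenFactor 1 n
  d  = prod (linearFactor 𝟙) 1 M
  o⁻ = oddProduct (⊝ 𝟙) n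

theorem3p13 : (n : ℕ) →
    sumTo n (λ k → sgn (ceilHalf k) * atℤ pobar (+ n - + tri k))
    ≡ sumSym n (λ k → sgnℤ k * atℤ pd (+ n - k * (+ 3 * k + + 1)))
theorem3p13 n = begin
  -- The terms with n < k ≤ 2n vanish because k ≤ `tri k` makes the argument of `pobar` negative.
  sumTo n g                                      ≡⟨ sumTo-extend g-vanishes (n ℕ.* 1) ⟨
  sumTo (n ℕ.+ n ℕ.* 1) g                        ≡⟨ cong (λ m → sumTo m g) (ℕₚ.*-suc n 1) ⟨
  sumTo (n ℕ.* 2) g                              ≡⟨ triangularSum pobar n n ⟨
  (triangularSeries n ⊗ overpartitionSeries) n   ≡⟨ coeff≤ (triangular-pentagonal n) n ℕₚ.≤-refl ⟩
  (pentagonalSeries n ⊗ distinctSeries) n        ≡⟨ pentagonalSum pd n n ⟩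
  sumSym n (λ k → sgnℤ k * atℤ pd (+ n - k * (+ 3 * k + + 1))) ∎
  where
  open ≡-Reasoning
  g : ℕ → ℤ
  g k = sgn (ceilHalf k) * atℤ pobar (+ n - + tri k)
  g-vanishes : ∀ k → n < k → g k ≡ + 0
  g-vanishes k n<k =
    trans (cong (sgn (ceilHalf k) *_) (Extraction.atℤ-vanishes pobar n (ℕₚ.<-≤-trans n<k (k≤tri k))))
          (ℤₚ.*-zeroʳ (sgn (ceilHalf k)))
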